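{- There is no non-trivial cycle of length $8$ or less. There is no non-trivial cycle of length $11$ or less having exactly two runs (i.e., exactly two even terms in one period).
   Context: The subprime Fibonacci rule: from positive integers $x,y$ with $s=x+y$, the next term is $s$ if $s$ is prime and $s/p$ if $s$ is composite, where $p$ is the smallest prime factor of $s$. A non-trivial cycle of length $m$ is an $m$-tuple $(t_1,\dots,t_m)$ of positive integers, indices read modulo $m$, such that for every $i$, $t_i$ is obtained from $t_{i-2},t_{i-1}$ by this rule, the $t_i$ are not all equal, and $m$ is the minimal period. A run is a maximal block of consecutive odd terms together with the even term that follows it; the number of runs of a cycle is the number of even terms among $t_1,\dots,t_m$. -}

module Defs where

open import Data.Nat using (ℕ; zero; suc; _+_; _*_; _≤_; _<_; _%_)
open import Data.Nat.Divisibility using (_∣_)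
open import Data.Nat.Primality using (Prime)
open import Data.Product using (_×_; ∃-syntax)
open import Data.Sum using (_⊎_)
open import Relation.Nullary using (¬_)
open import Relation.Binary.PropositionalEquality using (_≡_; _≢_)

SmallestPrimeFactor : ℕ → ℕ → Set
SmallestPrimeFactor p s = Prime p × p ∣ s × (∀ q → Prime q → q ∣ s → p ≤ q)

-- z is obtained from x , y by the subprime Fibonacci rule:
-- with s = x + y, z = s if s is prime, and z = s / p if s is composite
-- (s ≥ 2 here as x, y are positive, so "not prime" = "composite")
Next : ℕ → ℕ → ℕ → Set
Next x y z =
  (Prime (x + y) × z ≡ x + y)
  ⊎ (¬ Prime (x + y) × ∃[ p ] (SmallestPrimeFactor p (x + y) × z * p ≡ x + y))

-- A cycle of length m, represented as its m-periodic extension t : ℕ → ℕ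
-- (t_i for i = 0 .. m-1 is the tuple, indices read modulo m).
record NontrivialCycle (m : ℕ) (t : ℕ → ℕ) : Set where
  field
    m-pos       : 0 < m
    periodic    : ∀ i → t (i + m) ≡ t i
    positive    : ∀ i → 0 < t i
    rule        : ∀ i → Next (t i) (t (suc i)) (t (suc (suc i)))
    not-const   : ∃[ i ] ∃[ j ] t i ≢ t j
    minimal     : ∀ k → 0 < k → k < m → ¬ (∀ i → t (i + k) ≡ t i)

evenCount : (ℕ → ℕ) → ℕ → ℕ
evenCount t zero = zero
evenCount t (suc n) with t n % 2
... | zero  = suc (evenCount t n)
... | suc _ = evenCount t n

runs : ℕ → (ℕ → ℕ) → ℕ
runs m t = evenCount t m

{-# OPTIONS --safe #-}
module Submission where

-- A divisor p ≥ 2 makes a term at most the mean of its two predecessors, so in a non-trivial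
-- cycle the largest term is a prime equal to the sum of its predecessors, and exactly one of
-- these is even. No two consecutive terms are even, so each even term is followed by at least
-- two odd ones, the sums leading to those two are odd, and every other sum of a run is halved.
-- A cycle with two runs is therefore a positive fixed vector of a product of two matrices that
-- depends on the run lengths and on four odd divisors, one of which is 1 because of the largest
-- term. The characteristic equation at the eigenvalue 1 has few solutions in odd numbers: a tree
-- search on lower bounds for the divisors finds them all, closing a branch once one side of the
-- equation dominates the other coefficientwise. Each solution fixes the ratio of the largest
-- term to its neighbour, hence both terms, since the largest is prime; the sequence that they
-- generate does not return. A cycle with one run is traversed twice to get two.
-- So a cycle of length at most 11 has at least three runs, and a run has length at least 3.

open import Defs
open import Data.Bool using (Bool; true; false; _∧_; _∨_; not; if_then_else_; T)
open import Data.Bool.Properties using (T-∧; T-∨; T-not-≡; T?)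
open import Data.Empty using (⊥; ⊥-elim)
open import Data.Fin using (Fin; zero; suc)
open import Data.List using (List; []; _∷_; map)
open import Data.List.Relation.Unary.All using ([]; _∷_)
open import Data.Nat using (ℕ; zero; suc; _+_; _*_; _∸_; _^_; _≤_; _<_; _≤ᵇ_; _<ᵇ_; _≡ᵇ_; _≤?_; _≟_; _/_; _%_; z≤n; s≤s;
  NonZero; >-nonZero; n>1⇒nonTrivial; nonTrivial⇒n>1)
open import Data.Nat.Divisibility
open import Data.Nat.DivMod using (m*n/n≡m; m≡m%n+[m/n]*n; m%n<n)
open import Data.Nat.ListAction using (product)
open import Data.Nat.Primality
open import Data.Nat.Primality.Factorisation using (factorise)
open import Data.Nat.Properties
open import Data.Nat.Tactic.RingSolver using (solve-∀)
open import Data.Product using (_×_; _,_; ∃-syntax; proj₁; proj₂)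
open import Data.Sum using (_⊎_; inj₁; inj₂)
open import Data.Vec using (Vec; []; _∷_; lookup; tabulate; _[_]≔_)
open import Data.Vec.Properties using (lookup∘tabulate)
open import Data.Vec.Relation.Binary.Pointwise.Inductive using (Pointwise; []; _∷_)
open import Function using (_∘_)
open import Function.Bundles using (Equivalence)
open import Relation.Binary.PropositionalEquality
open import Relation.Nullary using (¬_; Dec; yes; no; contradiction)
open import Relation.Nullary.Decidable using (_→-dec_; _⊎-dec_; from-yes)
open import Relation.Unary using (Decidable)

-- Polynomials with natural coefficients

-- A polynomial in 1 + n variables lists its coefficients in the first one, constant term first.
Poly : ℕ → Set
Poly zero    = ℕ
Poly (suc n) = List (Poly n)

constP : ∀ n → ℕ → Poly n
constP zero    c = c
constP (suc n) c = constP n c ∷ []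

varP : ∀ {n} → Fin n → Poly n
varP {suc n} zero    = constP n 0 ∷ constP n 1 ∷ []
varP {suc n} (suc i) = varP i ∷ []

addP : ∀ n → Poly n → Poly n → Poly n
addP zero    f        g        = f + g
addP (suc n) []       g        = g
addP (suc n) (f ∷ fs) []       = f ∷ fs
addP (suc n) (f ∷ fs) (g ∷ gs) = addP n f g ∷ addP (suc n) fs gs

mulP : ∀ n → Poly n → Poly n → Poly n
mulP zero    f        g = f * g
mulP (suc n) []       g = []
mulP (suc n) (f ∷ fs) g = addP (suc n) (map (mulP n f) g) (constP n 0 ∷ mulP (suc n) fs g)

-- Coefficientwise comparison, absent coefficients counting as 0. It is a sufficient test because
-- the variables take natural values.
leP : ∀ n → Poly n → Poly n → Bool
leP zero    f        g        = f ≤ᵇ g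
leP (suc n) []       g        = true
leP (suc n) (f ∷ fs) []       = leP n f (constP n 0) ∧ leP (suc n) fs []
leP (suc n) (f ∷ fs) (g ∷ gs) = leP n f g ∧ leP (suc n) fs gs

-- Strictness is asked of the constant term alone, since all variables may be 0.
ltP : ∀ n → Poly n → Poly n → Bool
ltP zero    f        g        = f <ᵇ g
ltP (suc n) f        []       = false
ltP (suc n) []       (g ∷ gs) = ltP n (constP n 0) g
ltP (suc n) (f ∷ fs) (g ∷ gs) = ltP n f g ∧ leP (suc n) fs gs

infixl 6 _⊕_
infixl 7 _⊗_

data Expr (n : ℕ) : Set where
  con : ℕ → Expr n
  var : Fin n → Expr n
  _⊕_ : Expr n → Expr n → Expr n
  _⊗_ : Expr n → Expr n → Expr n

⟦_⟧ : ∀ {n} → Expr n → Vec ℕ n → ℕ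
⟦ con c ⟧ xs = c
⟦ var i ⟧ xs = lookup xs i
⟦ e ⊕ f ⟧ xs = ⟦ e ⟧ xs + ⟦ f ⟧ xs
⟦ e ⊗ f ⟧ xs = ⟦ e ⟧ xs * ⟦ f ⟧ xs

expand : ∀ {m n} → Expr m → Vec (Poly n) m → Poly n
expand {n = n} (con c) fs = constP n c
expand (var i) fs = lookup fs i
expand {n = n} (d ⊕ e) fs = addP n (expand d fs) (expand e fs)
expand {n = n} (d ⊗ e) fs = mulP n (expand d fs) (expand e fs)

-- Tree search over ranges of odd divisors

-- from v stands for the numbers v + 2n.
data Range : Set where
  exactly from : ℕ → Range

rangePoly : ∀ {n} → Range → Fin n → Poly n
rangePoly {n} (exactly v) i = constP n v
rangePoly {n} (from v)    i = addP n (constP n v) (mulP n (constP n 2) (varP i))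

rangePolys : ∀ {n} → Vec Range n → Vec (Poly n) n
rangePolys rs = tabulate λ i → rangePoly (lookup rs i) i

separated : ∀ n → Poly n → Poly n → Bool
separated n f g = ltP n f g ∨ ltP n g f

base : Range → ℕ
base (exactly v) = v
base (from v)    = v

-- Branching on the free variable with the least lower bound raises all the bounds evenly.
choose : ∀ {n} → Vec Range n → Vec ℕ n ⊎ Fin n
choose [] = inj₁ []
choose (exactly v ∷ rs) with choose rs
... | inj₁ xs = inj₁ (v ∷ xs)
... | inj₂ i  = inj₂ (suc i)
choose (from v ∷ rs) with choose rs
... | inj₁ xs = inj₂ zero
... | inj₂ i  = inj₂ (if v ≤ᵇ base (lookup rs i) then zero else suc i)

record Mat (A : Set) : Set where
  constructor mat
  field
    m₁₁ m₁₂ m₂₁ m₂₂ : A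
open Mat

-- The two sides are those of `K² - (a + d) K + (ad - bc) = 0` with the negative terms moved across:
-- eigenvalue `K` of an integral matrix stands for eigenvalue 1 of the rational one.
charSeparated : ∀ n → Poly n → Mat (Poly n) → Bool
charSeparated n K (mat a b c d) =
  separated n (addP n (mulP n K K) (mulP n a d)) (addP n (mulP n K (addP n a d)) (mulP n b c))

expandMat : ∀ {m n} → Mat (Expr m) → Vec (Poly n) m → Mat (Poly n)
expandMat (mat a b c d) fs = mat (expand a fs) (expand b fs) (expand c fs) (expand d fs)

module Search {n} (K : Expr n) (M : Mat (Expr n)) (leaf : Vec ℕ n → Bool) where

  closed : Vec (Poly n) n → Bool
  closed fs = charSeparated n (expand K fs) (expandMat M fs)

  mutual
    search : ℕ → Vec Range n → Bool
    -- Running out of fuel counts as failure, so a truncated search proves nothing.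
    search zero       rs = false
    search (suc fuel) rs = closed (rangePolys rs) ∨ branch fuel rs (choose rs)

    branch : ℕ → Vec Range n → Vec ℕ n ⊎ Fin n → Bool
    branch fuel rs (inj₁ xs) = leaf xs
    branch fuel rs (inj₂ i)  = split fuel rs i (lookup rs i)

    split : ℕ → Vec Range n → Fin n → Range → Bool
    split fuel rs i (exactly v) = false
    split fuel rs i (from v)    = search fuel (rs [ i ]≔ exactly v) ∧ search fuel (rs [ i ]≔ from (2 + v))

-- Matrices of runs and of two-run cycles

-- The `j`-th power of the step `(x, y) ↦ (y, (x + y) / 2)`, multiplied by `2 ^ j` to keep the
-- entries integral.
averages : ℕ → Mat ℕ
averages zero = mat 1 0 0 1
averages (suc j) with averages j
... | mat a b c d = mat (2 * c) (2 * d) (a + c) (b + d)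

productᴹ : ∀ {n} → Mat (Expr n) → Mat (Expr n) → Mat (Expr n)
productᴹ (mat a b c d) (mat p q r s) = mat (a ⊗ p ⊕ b ⊗ r) (a ⊗ q ⊕ b ⊗ s) (c ⊗ p ⊕ d ⊗ r) (c ⊗ q ⊕ d ⊗ s)

runScale : ∀ {n} → ℕ → Expr n → Expr n → Expr n
runScale j p q = con (2 ^ j) ⊗ (p ⊗ q)

-- Takes the first two odd terms of a run to those of the next run, scaled by `runScale j p q`. If
-- the run ends in `x`, `e`, then `a′ p = x + e` and `b′ q = e + a′`, so that `pq a′ = q (x + e)`
-- and `pq b′ = p e + (x + e)`.
runMat : ∀ {n} → ℕ → Expr n → Expr n → Mat (Expr n)
runMat j p q with averages j
... | mat a b c d = mat (con (a + c) ⊗ q) (con (b + d) ⊗ q) (p ⊗ con c ⊕ con (a + c)) (p ⊗ con d ⊕ con (b + d))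

-- p₁, q₁ are the divisors yielding the first two odd terms of the first run, p₂, q₂ those of the second.
p₁ q₁ p₂ q₂ : Expr 4
p₁ = var zero
q₁ = var (suc zero)
p₂ = var (suc (suc zero))
q₂ = var (suc (suc (suc zero)))

-- The divisors in a run's matrix belong to the run after it. Hence the first run, with `i`
-- averaging steps, is paired with `p₂`, `q₂`.
scale : ℕ → ℕ → Expr 4
scale i j = runScale i p₂ q₂ ⊗ runScale j p₁ q₁

cycleMat : ℕ → ℕ → Mat (Expr 4)
cycleMat i j = productᴹ (runMat j p₁ q₁) (runMat i p₂ q₂)

-- The rule as a program and the check at the leaves

quot : ℕ → ℕ → ℕ
quot n zero    = 0
quot n (suc d) = n / suc d

-- The candidates start at suc d.
leastFactor : ℕ → ℕ → ℕ → ℕ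
leastFactor zero       d s = suc d
leastFactor (suc fuel) d s = if s % suc d ≡ᵇ 0 then suc d else leastFactor fuel (suc d) s

-- Here `d` is to be the least factor of `s` from 2 on; it equals `s` exactly when `s` is prime.
subprime : ℕ → ℕ → ℕ
subprime s d = if d ≡ᵇ s then s else quot s d

next : ℕ → ℕ → ℕ
next x y = subprime (x + y) (leastFactor (x + y) 1 (x + y))

iterate : ℕ → ℕ → ℕ → ℕ × ℕ
iterate zero    x y = x , y
iterate (suc n) x y = iterate n y (next x y)

returns : ℕ × ℕ → ℕ × ℕ → Bool
returns (a , b) (c , d) = (a ≡ᵇ c) ∧ (b ≡ᵇ d)

euclid : ℕ → ℕ → ℕ → ℕ
euclid zero       m n       = m
euclid (suc fuel) m zero    = m
euclid (suc fuel) m (suc n) = euclid fuel (suc n) (m % suc n)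

-- That `g` divides `r` and `w` is tested here; that every common divisor divides `g` is
-- `euclid-greatest`. Together they make `g` the greatest common divisor.
leafWith : ℕ → ℕ → ℕ → ℕ → Bool
leafWith k r w g =
  (0 <ᵇ g) ∧ (g * quot r g ≡ᵇ r) ∧ (g * quot w g ≡ᵇ w) ∧
  not (returns (iterate k (quot r g) (quot w g)) (quot r g , quot w g))

-- The first two odd terms a, b are in the ratio r : w; the larger is prime, so r : w in lowest terms is a : b.
leafCheck : ℕ → ℕ → ℕ → Bool
leafCheck k r w = leafWith k r w (euclid 100 r w)

-- The top row `K a = m₁₁ a + m₁₂ b` gives `a : b = m₁₂ : (K - m₁₁)`. Each run has two terms besides
-- its averaging steps, whence the period `4 + i + j`.
leaf : ℕ → ℕ → Vec ℕ 4 → Bool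
leaf i j xs = leafCheck (4 + i + j) (⟦ m₁₂ (cycleMat i j) ⟧ xs) (⟦ scale i j ⟧ xs ∸ ⟦ m₁₁ (cycleMat i j) ⟧ xs)

-- The two searches correspond to the largest term being the first or the second odd term of its
-- run.
refuted : ℕ → ℕ → ℕ → Bool
refuted fuel i j =
  search fuel (exactly 1 ∷ from 1 ∷ from 1 ∷ from 1 ∷ []) ∧
  search fuel (from 1 ∷ exactly 1 ∷ from 1 ∷ from 1 ∷ [])
  where open Search (scale i j) (cycleMat i j) (leaf i j)

-- A record rather than a synonym, so that the search stays folded in types.
record Refuted (fuel i j : ℕ) : Set where
  constructor holds
  field
    check : T (refuted fuel i j)

-- Runs of lengths 3 + i and 3 + j take 1 + i and 1 + j averaging steps. The case i ≡ j
-- covers a single run, traversed twice.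
AllRefuted : ℕ → Set
AllRefuted fuel = ∀ {i} → i < 9 → ∀ {j} → j < 9 → i + j ≤ 5 ⊎ i ≡ j → Refuted fuel (1 + i) (1 + j)

-- Soundness of the search

eval : ∀ n → Poly n → Vec ℕ n → ℕ
eval zero    c        []       = c
eval (suc n) []       (x ∷ xs) = 0
eval (suc n) (f ∷ fs) (x ∷ xs) = eval n f xs + x * eval (suc n) fs (x ∷ xs)

eval-const : ∀ n c (xs : Vec ℕ n) → eval n (constP n c) xs ≡ c
eval-const zero    c []       = refl
eval-const (suc n) c (x ∷ xs) = begin
  eval n (constP n c) xs + x * 0 ≡⟨ cong₂ _+_ (eval-const n c xs) (*-zeroʳ x) ⟩
  c + 0                          ≡⟨ +-identityʳ c ⟩
  c                              ∎
  where open ≡-Reasoning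

eval-var : ∀ {n} (i : Fin n) xs → eval n (varP i) xs ≡ lookup xs i
eval-var {suc n} zero (x ∷ xs) = begin
  eval n (constP n 0) xs + x * (eval n (constP n 1) xs + x * 0)
    ≡⟨ cong₂ (λ a b → a + x * (b + x * 0)) (eval-const n 0 xs) (eval-const n 1 xs) ⟩
  x * (1 + x * 0)
    ≡⟨ trans (cong (λ a → x * suc a) (*-zeroʳ x)) (*-identityʳ x) ⟩
  x ∎
  where open ≡-Reasoning
eval-var (suc i) (x ∷ xs) = begin
  eval _ (varP i) xs + x * 0 ≡⟨ cong₂ _+_ (eval-var i xs) (*-zeroʳ x) ⟩
  lookup xs i + 0            ≡⟨ +-identityʳ _ ⟩
  lookup xs i                ∎
  where open ≡-Reasoning

eval-add : ∀ n f g xs → eval n (addP n f g) xs ≡ eval n f xs + eval n g xs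
eval-add zero    f        g        []       = refl
eval-add (suc n) []       g        (x ∷ xs) = refl
eval-add (suc n) (f ∷ fs) []       (x ∷ xs) = sym (+-identityʳ _)
eval-add (suc n) (f ∷ fs) (g ∷ gs) (x ∷ xs) = begin
  eval n (addP n f g) xs + x * eval (suc n) (addP (suc n) fs gs) (x ∷ xs)
    ≡⟨ cong₂ (λ a b → a + x * b) (eval-add n f g xs) (eval-add (suc n) fs gs (x ∷ xs)) ⟩
  (a + b) + x * (c + d) ≡⟨ rearrange a b c d x ⟩
  (a + x * c) + (b + x * d) ∎
  where
  open ≡-Reasoning
  a = eval n f xs
  b = eval n g xs
  c = eval (suc n) fs (x ∷ xs)
  d = eval (suc n) gs (x ∷ xs)
  rearrange : ∀ a b c d x → (a + b) + x * (c + d) ≡ (a + x * c) + (b + x * d)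
  rearrange = solve-∀

mutual
  eval-mul : ∀ n f g xs → eval n (mulP n f g) xs ≡ eval n f xs * eval n g xs
  eval-mul zero    f        g []       = refl
  eval-mul (suc n) []       g (x ∷ xs) = refl
  eval-mul (suc n) (f ∷ fs) g (x ∷ xs) = begin
    eval (suc n) (mulP (suc n) (f ∷ fs) g) (x ∷ xs)
      ≡⟨ eval-add (suc n) (map (mulP n f) g) (constP n 0 ∷ mulP (suc n) fs g) (x ∷ xs) ⟩
    eval (suc n) (map (mulP n f) g) (x ∷ xs) + (eval n (constP n 0) xs + x * eval (suc n) (mulP (suc n) fs g) (x ∷ xs))
      ≡⟨ cong₂ _+_ (eval-scale n f g x xs) (cong₂ _+_ (eval-const n 0 xs) (cong (x *_) (eval-mul (suc n) fs g (x ∷ xs)))) ⟩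
    a * b + x * (c * b) ≡⟨ rearrange a b c x ⟩
    (a + x * c) * b ∎
    where
    open ≡-Reasoning
    a = eval n f xs
    b = eval (suc n) g (x ∷ xs)
    c = eval (suc n) fs (x ∷ xs)
    rearrange : ∀ a b c x → a * b + x * (c * b) ≡ (a + x * c) * b
    rearrange = solve-∀

  eval-scale : ∀ n f g x xs → eval (suc n) (map (mulP n f) g) (x ∷ xs) ≡ eval n f xs * eval (suc n) g (x ∷ xs)
  eval-scale n f []       x xs = sym (*-zeroʳ (eval n f xs))
  eval-scale n f (g ∷ gs) x xs = begin
    eval n (mulP n f g) xs + x * eval (suc n) (map (mulP n f) gs) (x ∷ xs)
      ≡⟨ cong₂ (λ a b → a + x * b) (eval-mul n f g xs) (eval-scale n f gs x xs) ⟩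
    a * b + x * (a * c) ≡⟨ rearrange a b c x ⟩
    a * (b + x * c) ∎
    where
    open ≡-Reasoning
    a = eval n f xs
    b = eval n g xs
    c = eval (suc n) gs (x ∷ xs)
    rearrange : ∀ a b c x → a * b + x * (a * c) ≡ a * (b + x * c)
    rearrange = solve-∀

T-∧⁻ : ∀ {a b} → T (a ∧ b) → T a × T b
T-∧⁻ = Equivalence.to T-∧

leP-sound : ∀ n f g xs → T (leP n f g) → eval n f xs ≤ eval n g xs
leP-sound zero    f        g        []       le = ≤ᵇ⇒≤ f g le
leP-sound (suc n) []       g        (x ∷ xs) le = z≤n
leP-sound (suc n) (f ∷ fs) []       (x ∷ xs) le with p , q ← T-∧⁻ le = begin
  eval n f xs + x * eval (suc n) fs (x ∷ xs)
    ≤⟨ +-mono-≤ (leP-sound n f (constP n 0) xs p) (*-monoʳ-≤ x (leP-sound (suc n) fs [] (x ∷ xs) q)) ⟩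
  eval n (constP n 0) xs + x * 0 ≡⟨ cong₂ _+_ (eval-const n 0 xs) (*-zeroʳ x) ⟩
  0 ∎
  where open ≤-Reasoning
leP-sound (suc n) (f ∷ fs) (g ∷ gs) (x ∷ xs) le with p , q ← T-∧⁻ le =
  +-mono-≤ (leP-sound n f g xs p) (*-monoʳ-≤ x (leP-sound (suc n) fs gs (x ∷ xs) q))

ltP-sound : ∀ n f g xs → T (ltP n f g) → eval n f xs < eval n g xs
ltP-sound zero    f        g        []       lt = <ᵇ⇒< f g lt
ltP-sound (suc n) []       (g ∷ gs) (x ∷ xs) lt =
  m≤n⇒m≤n+o _ (subst (_< eval n g xs) (eval-const n 0 xs) (ltP-sound n (constP n 0) g xs lt))
ltP-sound (suc n) (f ∷ fs) (g ∷ gs) (x ∷ xs) lt with p , q ← T-∧⁻ lt =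
  +-mono-<-≤ (ltP-sound n f g xs p) (*-monoʳ-≤ x (leP-sound (suc n) fs gs (x ∷ xs) q))

separated-sound : ∀ n f g xs → T (separated n f g) → eval n f xs ≢ eval n g xs
separated-sound n f g xs sep with Equivalence.to (T-∨ {ltP n f g}) sep
... | inj₁ lt = <⇒≢ (ltP-sound n f g xs lt)
... | inj₂ gt = ≢-sym (<⇒≢ (ltP-sound n g f xs gt))

eval-expand : ∀ {m n} (e : Expr m) (fs : Vec (Poly n) m) ys xs →
              (∀ i → eval n (lookup fs i) ys ≡ lookup xs i) → eval n (expand e fs) ys ≡ ⟦ e ⟧ xs
eval-expand (con c) fs ys xs fs≡xs = eval-const _ c ys
eval-expand (var i) fs ys xs fs≡xs = fs≡xs i
eval-expand (d ⊕ e) fs ys xs fs≡xs =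
  trans (eval-add _ (expand d fs) (expand e fs) ys) (cong₂ _+_ (eval-expand d fs ys xs fs≡xs) (eval-expand e fs ys xs fs≡xs))
eval-expand (d ⊗ e) fs ys xs fs≡xs =
  trans (eval-mul _ (expand d fs) (expand e fs) ys) (cong₂ _*_ (eval-expand d fs ys xs fs≡xs) (eval-expand e fs ys xs fs≡xs))

-- The recorded offsets form the point at which the polynomials of `rangePolys` take the actual
-- divisors as values, so one comparison of coefficients settles a whole box.
data _∈_ (x : ℕ) : Range → Set where
  isBase : x ∈ exactly x
  above  : ∀ {v} n → x ≡ v + 2 * n → x ∈ from v

offset : ∀ {x r} → x ∈ r → ℕ
offset isBase      = 0
offset (above n _) = n

offsets : ∀ {n} {xs : Vec ℕ n} {rs : Vec Range n} → Pointwise _∈_ xs rs → Vec ℕ n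
offsets []       = []
offsets (p ∷ ps) = offset p ∷ offsets ps

eval-rangePoly : ∀ {n x} (r : Range) (i : Fin n) (p : x ∈ r) ys → lookup ys i ≡ offset p → eval n (rangePoly r i) ys ≡ x
eval-rangePoly {n} (exactly v) i isBase ys _ = eval-const n v ys
eval-rangePoly {n} {x} (from v) i (above k x≡v+2k) ys ysᵢ≡k = begin
  eval n (addP n (constP n v) (mulP n (constP n 2) (varP i))) ys
    ≡⟨ eval-add n (constP n v) _ ys ⟩
  eval n (constP n v) ys + eval n (mulP n (constP n 2) (varP i)) ys
    ≡⟨ cong₂ _+_ (eval-const n v ys) (eval-mul n (constP n 2) (varP i) ys) ⟩
  v + eval n (constP n 2) ys * eval n (varP i) ys
    ≡⟨ cong (v +_) (cong₂ _*_ (eval-const n 2 ys) (trans (eval-var i ys) ysᵢ≡k)) ⟩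
  v + 2 * k ≡⟨ x≡v+2k ⟨
  x ∎
  where open ≡-Reasoning

member : ∀ {n} {xs : Vec ℕ n} {rs : Vec Range n} → Pointwise _∈_ xs rs → ∀ i → lookup xs i ∈ lookup rs i
member (p ∷ ps) zero    = p
member (p ∷ ps) (suc i) = member ps i

lookup-offsets : ∀ {n} {xs : Vec ℕ n} {rs : Vec Range n} (ps : Pointwise _∈_ xs rs) i → lookup (offsets ps) i ≡ offset (member ps i)
lookup-offsets (p ∷ ps) zero    = refl
lookup-offsets (p ∷ ps) (suc i) = lookup-offsets ps i

eval-rangePolys : ∀ {n} {xs : Vec ℕ n} {rs : Vec Range n} (ps : Pointwise _∈_ xs rs) i →
                  eval n (lookup (rangePolys rs) i) (offsets ps) ≡ lookup xs i
eval-rangePolys {xs = xs} {rs} ps i = begin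
  eval _ (lookup (rangePolys rs) i) (offsets ps)
    ≡⟨ cong (λ f → eval _ f (offsets ps)) (lookup∘tabulate _ i) ⟩
  eval _ (rangePoly (lookup rs i) i) (offsets ps)
    ≡⟨ eval-rangePoly (lookup rs i) i (member ps i) (offsets ps) (lookup-offsets ps i) ⟩
  lookup xs i ∎
  where open ≡-Reasoning

narrow : ∀ {n} {xs : Vec ℕ n} {rs : Vec Range n} {r} i → Pointwise _∈_ xs rs → lookup xs i ∈ r → Pointwise _∈_ xs (rs [ i ]≔ r)
narrow zero    (p ∷ ps) q = q ∷ ps
narrow (suc i) (p ∷ ps) q = p ∷ narrow i ps q

choose-fixed : ∀ {n} {xs ys : Vec ℕ n} {rs : Vec Range n} → Pointwise _∈_ xs rs → choose rs ≡ inj₁ ys → ys ≡ xs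
choose-fixed [] refl = refl
choose-fixed {rs = exactly v ∷ rs} (isBase ∷ ps) eq with choose rs in eq′
choose-fixed {rs = exactly v ∷ rs} (isBase ∷ ps) refl | inj₁ ys = cong (v ∷_) (choose-fixed ps eq′)
choose-fixed {rs = from v ∷ rs} (p ∷ ps) eq with choose rs
choose-fixed {rs = from v ∷ rs} (p ∷ ps) () | inj₁ _
choose-fixed {rs = from v ∷ rs} (p ∷ ps) () | inj₂ _

charEq : ℕ → Mat ℕ → Set
charEq K (mat a b c d) = K * K + a * d ≡ K * (a + d) + b * c

⟦_⟧ᴹ : ∀ {n} → Mat (Expr n) → Vec ℕ n → Mat ℕ
⟦ mat a b c d ⟧ᴹ xs = mat (⟦ a ⟧ xs) (⟦ b ⟧ xs) (⟦ c ⟧ xs) (⟦ d ⟧ xs)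

-- The given `xs` is followed down the tree through the boxes containing it. It ends at a closed
-- node, contradicting `ch`, or at a leaf, contradicting `leaf-sound`.
module SearchSound {n} (K : Expr n) (M : Mat (Expr n)) (leaf : Vec ℕ n → Bool)
  (xs : Vec ℕ n) (ch : charEq (⟦ K ⟧ xs) (⟦ M ⟧ᴹ xs)) (leaf-sound : T (leaf xs) → ⊥) where

  open Search K M leaf

  closed-sound : ∀ {rs} → Pointwise _∈_ xs rs → T (closed (rangePolys rs)) → ⊥
  closed-sound {rs} ps sep = separated-sound n (expand (K ⊗ K ⊕ m₁₁ M ⊗ m₂₂ M) fs)
      (expand (K ⊗ (m₁₁ M ⊕ m₂₂ M) ⊕ m₁₂ M ⊗ m₂₁ M) fs) (offsets ps) sep (begin
    eval n (expand (K ⊗ K ⊕ m₁₁ M ⊗ m₂₂ M) fs) (offsets ps)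
      ≡⟨ eval-expand (K ⊗ K ⊕ m₁₁ M ⊗ m₂₂ M) fs (offsets ps) xs (eval-rangePolys ps) ⟩
    ⟦ K ⊗ K ⊕ m₁₁ M ⊗ m₂₂ M ⟧ xs
      ≡⟨ ch ⟩
    ⟦ K ⊗ (m₁₁ M ⊕ m₂₂ M) ⊕ m₁₂ M ⊗ m₂₁ M ⟧ xs
      ≡⟨ eval-expand (K ⊗ (m₁₁ M ⊕ m₂₂ M) ⊕ m₁₂ M ⊗ m₂₁ M) fs (offsets ps) xs (eval-rangePolys ps) ⟨
    eval n (expand (K ⊗ (m₁₁ M ⊕ m₂₂ M) ⊕ m₁₂ M ⊗ m₂₁ M) fs) (offsets ps) ∎)
    where
    open ≡-Reasoning
    fs = rangePolys rs

  mutual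
    search-sound : ∀ fuel {rs} → Pointwise _∈_ xs rs → T (search fuel rs) → ⊥
    search-sound (suc fuel) {rs} ps t with Equivalence.to (T-∨ {closed (rangePolys rs)}) t
    ... | inj₁ cl = closed-sound ps cl
    ... | inj₂ br = branch-sound fuel ps (choose rs) refl br

    branch-sound : ∀ fuel {rs} → Pointwise _∈_ xs rs → ∀ c → choose rs ≡ c → T (branch fuel rs c) → ⊥
    branch-sound fuel ps (inj₁ ys) eq t = leaf-sound (subst (T ∘ leaf) (choose-fixed ps eq) t)
    branch-sound fuel {rs} ps (inj₂ i) eq t = split-sound fuel ps i (lookup rs i) (member ps i) t

    split-sound : ∀ fuel {rs} → Pointwise _∈_ xs rs → ∀ i r → lookup xs i ∈ r → T (split fuel rs i r) → ⊥
    split-sound fuel {rs} ps i (from v) (above k eq) t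
      with T-∧⁻ {search fuel (rs [ i ]≔ exactly v)} {search fuel (rs [ i ]≔ from (2 + v))} t
    split-sound fuel ps i (from v) (above zero eq) t | t₁ , _ =
      search-sound fuel (narrow i ps (subst (λ w → lookup xs i ∈ exactly w) (trans eq (+-identityʳ v)) isBase)) t₁
    split-sound fuel ps i (from v) (above (suc k) eq) t | _ , t₂ =
      search-sound fuel (narrow i ps (above {v = 2 + v} k (trans eq (step v k)))) t₂
      where
      step : ∀ v k → v + 2 * suc k ≡ 2 + v + 2 * k
      step = solve-∀

-- Linear algebra of a run

record Linear (K : ℕ) (M : Mat ℕ) (a b a′ b′ : ℕ) : Set where
  constructor linear
  field
    top    : K * a′ ≡ m₁₁ M * a + m₁₂ M * b
    bottom : K * b′ ≡ m₂₁ M * a + m₂₂ M * b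

_⊠_ : Mat ℕ → Mat ℕ → Mat ℕ
mat a b c d ⊠ mat p q r s = mat (a * p + b * r) (a * q + b * s) (c * p + d * r) (c * q + d * s)

Linear-compose : ∀ {K M K′ M′ a b a′ b′ a″ b″} → Linear K M a b a′ b′ → Linear K′ M′ a′ b′ a″ b″ →
                 Linear (K * K′) (M′ ⊠ M) a b a″ b″
Linear-compose {K} {mat p q r s} {K′} {mat p′ q′ r′ s′} {a} {b} {a′} {b′} (linear e f) (linear e′ f′) =
  linear (row p′ q′ e′) (row r′ s′ f′)
  where
  open ≡-Reasoning
  pull : ∀ K K′ z → K * K′ * z ≡ K * (K′ * z)
  pull = solve-∀
  push : ∀ K x y a′ b′ → K * (x * a′ + y * b′) ≡ x * (K * a′) + y * (K * b′)
  push = solve-∀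
  collect : ∀ x y p q r s a b → x * (p * a + q * b) + y * (r * a + s * b) ≡ (x * p + y * r) * a + (x * q + y * s) * b
  collect = solve-∀
  row : ∀ x y {z} → K′ * z ≡ x * a′ + y * b′ → K * K′ * z ≡ (x * p + y * r) * a + (x * q + y * s) * b
  row x y {z} g = begin
    K * K′ * z                                    ≡⟨ pull K K′ z ⟩
    K * (K′ * z)                                  ≡⟨ cong (K *_) g ⟩
    K * (x * a′ + y * b′)                         ≡⟨ push K x y a′ b′ ⟩
    x * (K * a′) + y * (K * b′)                   ≡⟨ cong₂ (λ u v → x * u + y * v) e f ⟩
    x * (p * a + q * b) + y * (r * a + s * b)     ≡⟨ collect x y p q r s a b ⟩
    (x * p + y * r) * a + (x * q + y * s) * b     ∎

-- A positive fixed vector makes `K` an eigenvalue of `M`. To avoid subtraction, both sides are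
-- multiplied by `a * b`, the rows are substituted into `(K a)(K b)`, and `a * b` is cancelled.
Linear-fixed : ∀ {K M a b} → 0 < a → 0 < b → Linear K M a b a b → charEq K M
Linear-fixed {K} {mat p q r s} {a} {b} a>0 b>0 (linear e f) =
  *-cancelʳ-≡ _ _ (a * b) {{m*n≢0 a b {{>-nonZero a>0}} {{>-nonZero b>0}}}} (begin
    (K * K + p * s) * (a * b)                               ≡⟨ l₁ K p s a b ⟩
    (K * a) * (K * b) + p * s * (a * b)                     ≡⟨ cong₂ (λ u v → u * v + p * s * (a * b)) e f ⟩
    (p * a + q * b) * (r * a + s * b) + p * s * (a * b)     ≡⟨ l₂ p q r s a b ⟩
    p * a * (r * a + s * b) + s * b * (p * a + q * b) + q * r * (a * b)
      ≡⟨ cong₂ (λ u v → p * a * v + s * b * u + q * r * (a * b)) e f ⟨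
    p * a * (K * b) + s * b * (K * a) + q * r * (a * b)     ≡⟨ l₃ K p q r s a b ⟩
    (K * (p + s) + q * r) * (a * b)                         ∎)
  where
  open ≡-Reasoning
  l₁ : ∀ K p s a b → (K * K + p * s) * (a * b) ≡ (K * a) * (K * b) + p * s * (a * b)
  l₁ = solve-∀
  l₂ : ∀ p q r s a b → (p * a + q * b) * (r * a + s * b) + p * s * (a * b)
       ≡ p * a * (r * a + s * b) + s * b * (p * a + q * b) + q * r * (a * b)
  l₂ = solve-∀
  l₃ : ∀ K p q r s a b → p * a * (K * b) + s * b * (K * a) + q * r * (a * b) ≡ (K * (p + s) + q * r) * (a * b)
  l₃ = solve-∀

averages-linear : ∀ j (u : ℕ → ℕ) → (∀ l → l < j → u (2 + l) * 2 ≡ u l + u (1 + l)) →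
                  Linear (2 ^ j) (averages j) (u 0) (u 1) (u j) (u (1 + j))
averages-linear zero    u avg = linear (id₁ (u 0) (u 1)) (id₂ (u 0) (u 1))
  where
  id₁ : ∀ x y → 1 * x ≡ 1 * x + 0 * y
  id₁ = solve-∀
  id₂ : ∀ x y → 1 * y ≡ 0 * x + 1 * y
  id₂ = solve-∀
averages-linear (suc j) u avg with averages j | averages-linear j u (λ l l<j → avg l (m<n⇒m<1+n l<j))
... | mat p q r s | linear e f = linear first second
  where
  open ≡-Reasoning
  l₁ : ∀ r s x y → 2 * (r * x + s * y) ≡ 2 * r * x + 2 * s * y
  l₁ = solve-∀
  l₂ : ∀ N z → 2 * N * z ≡ N * (z * 2)
  l₂ = solve-∀
  l₃ : ∀ p q r s x y → (p * x + q * y) + (r * x + s * y) ≡ (p + r) * x + (q + s) * y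
  l₃ = solve-∀
  first : 2 ^ suc j * u (1 + j) ≡ 2 * r * u 0 + 2 * s * u 1
  first = begin
    2 * 2 ^ j * u (1 + j)     ≡⟨ *-assoc 2 (2 ^ j) (u (1 + j)) ⟩
    2 * (2 ^ j * u (1 + j))   ≡⟨ cong (2 *_) f ⟩
    2 * (r * u 0 + s * u 1)   ≡⟨ l₁ r s (u 0) (u 1) ⟩
    2 * r * u 0 + 2 * s * u 1 ∎
  second : 2 ^ suc j * u (2 + j) ≡ (p + r) * u 0 + (q + s) * u 1
  second = begin
    2 * 2 ^ j * u (2 + j)                         ≡⟨ l₂ (2 ^ j) (u (2 + j)) ⟩
    2 ^ j * (u (2 + j) * 2)                       ≡⟨ cong (2 ^ j *_) (avg j ≤-refl) ⟩
    2 ^ j * (u j + u (1 + j))                     ≡⟨ *-distribˡ-+ (2 ^ j) (u j) (u (1 + j)) ⟩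
    2 ^ j * u j + 2 ^ j * u (1 + j)               ≡⟨ cong₂ _+_ e f ⟩
    (p * u 0 + q * u 1) + (r * u 0 + s * u 1)     ≡⟨ l₃ p q r s (u 0) (u 1) ⟩
    (p + r) * u 0 + (q + s) * u 1                 ∎

run-linear : ∀ {n} j (p q : Expr n) xs {a b x e a′ b′} → Linear (2 ^ j) (averages j) a b x e →
             a′ * ⟦ p ⟧ xs ≡ x + e → b′ * ⟦ q ⟧ xs ≡ e + a′ →
             Linear (⟦ runScale j p q ⟧ xs) (⟦ runMat j p q ⟧ᴹ xs) a b a′ b′
run-linear j pe qe xs {a} {b} {x} {e} {a′} {b′} (linear ex ee) ea eb = linear first second
  where
  open ≡-Reasoning
  N = 2 ^ j
  p = ⟦ pe ⟧ xs
  q = ⟦ qe ⟧ xs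
  α = m₁₁ (averages j)
  β = m₁₂ (averages j)
  γ = m₂₁ (averages j)
  δ = m₂₂ (averages j)
  l₁ : ∀ N p q a′ → N * (p * q) * a′ ≡ q * (N * (a′ * p))
  l₁ = solve-∀
  l₂ : ∀ q α β γ δ a b → q * (α * a + β * b + (γ * a + δ * b)) ≡ (α + γ) * q * a + (β + δ) * q * b
  l₂ = solve-∀
  l₃ : ∀ N p q b′ → N * (p * q) * b′ ≡ p * (N * (b′ * q))
  l₃ = solve-∀
  l₄ : ∀ N p e a′ → p * (N * (e + a′)) ≡ p * (N * e) + N * (a′ * p)
  l₄ = solve-∀
  l₅ : ∀ p α β γ δ a b → p * (γ * a + δ * b) + (α * a + β * b + (γ * a + δ * b))
       ≡ (p * γ + (α + γ)) * a + (p * δ + (β + δ)) * b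
  l₅ = solve-∀
  sum : N * (a′ * p) ≡ α * a + β * b + (γ * a + δ * b)
  sum = begin
    N * (a′ * p)     ≡⟨ cong (N *_) ea ⟩
    N * (x + e)      ≡⟨ *-distribˡ-+ N x e ⟩
    N * x + N * e    ≡⟨ cong₂ _+_ ex ee ⟩
    α * a + β * b + (γ * a + δ * b) ∎
  first : N * (p * q) * a′ ≡ (α + γ) * q * a + (β + δ) * q * b
  first = begin
    N * (p * q) * a′                      ≡⟨ l₁ N p q a′ ⟩
    q * (N * (a′ * p))                    ≡⟨ cong (q *_) sum ⟩
    q * (α * a + β * b + (γ * a + δ * b)) ≡⟨ l₂ q α β γ δ a b ⟩
    (α + γ) * q * a + (β + δ) * q * b     ∎
  second : N * (p * q) * b′ ≡ (p * γ + (α + γ)) * a + (p * δ + (β + δ)) * b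
  second = begin
    N * (p * q) * b′                      ≡⟨ l₃ N p q b′ ⟩
    p * (N * (b′ * q))                    ≡⟨ cong (λ u → p * (N * u)) eb ⟩
    p * (N * (e + a′))                    ≡⟨ l₄ N p e a′ ⟩
    p * (N * e) + N * (a′ * p)            ≡⟨ cong₂ (λ u v → p * u + v) ee sum ⟩
    p * (γ * a + δ * b) + (α * a + β * b + (γ * a + δ * b)) ≡⟨ l₅ p α β γ δ a b ⟩
    (p * γ + (α + γ)) * a + (p * δ + (β + δ)) * b ∎

-- The rule as a function, and the solutions of the characteristic equation

∃-primeFactor : ∀ n → 1 < n → ∃[ p ] Prime p × p ∣ n
∃-primeFactor n n>1 with factorise n {{>-nonZero (<-trans (s≤s z≤n) n>1)}}
... | record { factors = [] ; isFactorisation = n≡1 } = contradiction (sym n≡1) (<⇒≢ n>1)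
... | record { factors = p ∷ ps ; isFactorisation = eq ; factorsPrime = pr ∷ _ } =
  p , pr , divides (product ps) (trans eq (*-comm p _))

-- Minimality among prime factors extends to all divisors above 1, because each of these has a prime
-- factor no larger than itself.
smallest⇒rough : ∀ {p s} → SmallestPrimeFactor p s → p Rough s
smallest⇒rough (_ , _ , least) (hasNonTrivialDivisor {d} {{nt}} d<p d∣s)
  with q , pr , q∣d ← ∃-primeFactor d (nonTrivial⇒n>1 d {{nt}}) =
  <⇒≱ d<p (≤-trans (least q pr (∣-trans q∣d d∣s)) (∣⇒≤ {{>-nonZero (<-trans (s≤s z≤n) (nonTrivial⇒n>1 d {{nt}}))}} q∣d))

-- Roughness excludes every candidate below `p`. The bound on `p` ensures that fuel can run out only
-- at the candidate `p` itself.
leastFactor-rough : ∀ fuel d {p s} → p Rough s → p ∣ s → 1 ≤ d → d < p → p ≤ suc d + fuel → leastFactor fuel d s ≡ p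
leastFactor-rough zero d {p} rough p∣s d≥1 d<p p≤ = ≤-antisym d<p (subst (p ≤_) (+-identityʳ (suc d)) p≤)
leastFactor-rough (suc fuel) d {p} {s} rough p∣s d≥1 d<p p≤ with s % suc d ≡ᵇ 0 in eq | m≤n⇒m<n∨m≡n d<p
... | false | inj₁ 1+d<p = leastFactor-rough fuel (suc d) rough p∣s (s≤s z≤n) 1+d<p (subst (p ≤_) (+-suc (suc d) fuel) p≤)
... | false | inj₂ refl  = ⊥-elim (subst T eq (≡⇒≡ᵇ _ 0 (n∣m⇒m%n≡0 s p p∣s)))
... | true  | inj₂ 1+d≡p = 1+d≡p
... | true  | inj₁ 1+d<p = ⊥-elim (rough (hasNonTrivialDivisor {{n>1⇒nonTrivial (s≤s d≥1)}} 1+d<p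
                                     (m%n≡0⇒n∣m s (suc d) (≡ᵇ⇒≡ _ 0 (subst T (sym eq) _)))))

quot-* : ∀ z p → 0 < p → quot (z * p) p ≡ z
quot-* z (suc p) _ = m*n/n≡m z (suc p)

if-eq : ∀ {A : Set} d s {x y z : A} → (d ≡ s → x ≡ z) → (d ≢ s → y ≡ z) → (if d ≡ᵇ s then x else y) ≡ z
if-eq d s eqCase neqCase with d ≡ᵇ s in eq
... | true  = eqCase (≡ᵇ⇒≡ d s (subst T (sym eq) _))
... | false = neqCase λ d≡s → subst T eq (≡⇒≡ᵇ d s d≡s)

Next⇒next : ∀ {x y z} → 0 < x + y → Next x y z → next x y ≡ z
Next⇒next {x} {y} {z} s>0 (inj₁ (pr , z≡s)) = if-eq d s (λ _ → sym z≡s) (λ d≢s → contradiction d≡s d≢s)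
  where
  s = x + y
  d = leastFactor s 1 s
  d≡s : d ≡ s
  d≡s = leastFactor-rough s 1 (prime⇒rough pr) ∣-refl ≤-refl (nonTrivial⇒n>1 s {{prime⇒nonTrivial pr}}) (m≤n+m s 2)
Next⇒next {x} {y} {z} s>0 (inj₂ (¬pr , p , spf@(pr , p∣s , _) , z*p≡s)) =
  if-eq d s (λ d≡s → contradiction (subst Prime (trans (sym d≡p) d≡s) pr) ¬pr) λ _ → begin
    quot s d       ≡⟨ cong₂ quot (sym z*p≡s) d≡p ⟩
    quot (z * p) p ≡⟨ quot-* z p (<-trans (s≤s z≤n) p>1) ⟩
    z              ∎
  where
  open ≡-Reasoning
  s = x + y
  d = leastFactor s 1 s
  p>1 : 1 < p
  p>1 = nonTrivial⇒n>1 p {{prime⇒nonTrivial pr}}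
  d≡p : d ≡ p
  d≡p = leastFactor-rough s 1 (smallest⇒rough spf) p∣s ≤-refl p>1 (≤-trans (∣⇒≤ {{>-nonZero s>0}} p∣s) (m≤n+m s 2))

iterate-next : ∀ {t : ℕ → ℕ} → (∀ i → 0 < t i) → (∀ i → Next (t i) (t (suc i)) (t (suc (suc i)))) → ∀ n i →
               iterate n (t i) (t (suc i)) ≡ (t (n + i) , t (suc (n + i)))
iterate-next pos rule zero    i = refl
iterate-next {t} pos rule (suc n) i = begin
  iterate n (t (suc i)) (next (t i) (t (suc i)))
    ≡⟨ cong (iterate n (t (suc i))) (Next⇒next {t i} {t (suc i)} (m≤n⇒m≤n+o _ (pos i)) (rule i)) ⟩
  iterate n (t (suc i)) (t (suc (suc i)))
    ≡⟨ iterate-next pos rule n (suc i) ⟩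
  (t (n + suc i) , t (suc (n + suc i)))
    ≡⟨ cong (λ m → t m , t (suc m)) (+-suc n i) ⟩
  (t (suc n + i) , t (suc (suc n + i))) ∎
  where open ≡-Reasoning

euclid-greatest : ∀ fuel {d} m n → d ∣ m → d ∣ n → d ∣ euclid fuel m n
euclid-greatest zero       m n       d∣m d∣n = d∣m
euclid-greatest (suc fuel) m zero    d∣m d∣n = d∣m
euclid-greatest (suc fuel) m (suc n) d∣m d∣n = euclid-greatest fuel (suc n) (m % suc n) d∣n (%-presˡ-∣ d∣m d∣n)

-- After cancelling `g`, `P W = Q R`. The prime `P` exceeds `Q`, so it divides `R`, say `R = c P`;
-- then `W = Q c`. Now `g c` divides both `g R` and `g W`, hence `g`, which forces `c = 1`.
primePart : ∀ {P Q R W} g → 0 < g → Prime P → 0 < Q → Q < P → P * (g * W) ≡ Q * (g * R) →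
            (∀ {d} → d ∣ g * R → d ∣ g * W → d ∣ g) → P ≡ R × Q ≡ W
primePart {P} {Q} {R} {W} g g>0 pr Q>0 Q<P eq greatest = result (euclidsLemma Q R pr P∣QR)
  where
  open ≡-Reasoning
  instance
    g≢0 : NonZero g
    g≢0 = >-nonZero g>0
    P≢0 : NonZero P
    P≢0 = prime⇒nonZero pr
  swap : ∀ g P W → g * (P * W) ≡ P * (g * W)
  swap = solve-∀
  PW≡QR : P * W ≡ Q * R
  PW≡QR = *-cancelˡ-≡ _ _ g (trans (swap g P W) (trans eq (sym (swap g Q R))))
  P∣QR : P ∣ Q * R
  P∣QR = divides W (trans (sym PW≡QR) (*-comm P W))
  result : P ∣ Q ⊎ P ∣ R → P ≡ R × Q ≡ W
  result (inj₁ P∣Q) = contradiction (∣⇒≤ {{>-nonZero Q>0}} P∣Q) (<⇒≱ Q<P)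
  result (inj₂ (divides c R≡cP)) = P≡R , Q≡W
    where
    W≡Qc : W ≡ Q * c
    W≡Qc = *-cancelˡ-≡ _ _ P (begin
      P * W       ≡⟨ PW≡QR ⟩
      Q * R       ≡⟨ cong (Q *_) R≡cP ⟩
      Q * (c * P) ≡⟨ swap Q c P ⟩
      c * (Q * P) ≡⟨ rotate c Q P ⟩
      P * (Q * c) ∎)
      where
      rotate : ∀ c Q P → c * (Q * P) ≡ P * (Q * c)
      rotate = solve-∀
    c≡1 : c ≡ 1
    c≡1 = ∣1⇒≡1 (*-cancelˡ-∣ g (subst (g * c ∣_) (sym (*-identityʳ g))
      (greatest (*-monoʳ-∣ g (divides P (trans R≡cP (*-comm c P)))) (*-monoʳ-∣ g (divides Q W≡Qc)))))
    P≡R : P ≡ R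
    P≡R = sym (trans R≡cP (trans (cong (_* P) c≡1) (*-identityˡ P)))
    Q≡W : Q ≡ W
    Q≡W = sym (trans W≡Qc (trans (cong (Q *_) c≡1) (*-identityʳ Q)))

PrimeMax : ℕ → ℕ → Set
PrimeMax a b = Prime a × b < a

returns-refl : ∀ p → T (returns p p)
returns-refl (a , b) = Equivalence.from T-∧ (≡⇒≡ᵇ a a refl , ≡⇒≡ᵇ b b refl)

-- `primePart`, with the roles exchanged if `b` is the prime, identifies `(a , b)` with the reduced
-- pair, whose computed orbit fails to return.
leaf-sound : ∀ {k r w a b} → 0 < a → 0 < b → PrimeMax a b ⊎ PrimeMax b a → a * w ≡ b * r →
             iterate k a b ≡ (a , b) → ¬ T (leafCheck k r w)
leaf-sound {k} {r} {w} {a} {b} a>0 b>0 pm eq it t = go (euclid 100 r w) (euclid-greatest 100 r w) t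
  where
  go : ∀ g → (∀ {d} → d ∣ r → d ∣ w → d ∣ g) → ¬ T (leafWith k r w g)
  go g greatest t
    with t₀ , t′ ← T-∧⁻ {0 <ᵇ g} t
    with t₁ , t₂ ← T-∧⁻ {g * quot r g ≡ᵇ r} t′
    with t₃ , t₄ ← T-∧⁻ {g * quot w g ≡ᵇ w} t₂ =
    not-returns (≡ᵇ⇒≡ _ _ t₁) (≡ᵇ⇒≡ _ _ t₃) t₄
    where
    R = quot r g
    W = quot w g
    not-returns : g * R ≡ r → g * W ≡ w → ¬ T (not (returns (iterate k R W) (R , W)))
    not-returns gR≡r gW≡w t = refute (values pm)
      where
      refute : a ≡ R × b ≡ W → ⊥
      refute (a≡R , b≡W) = subst T (Equivalence.to T-not-≡ t) (subst (λ p → T (returns p (R , W)))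
        (trans (sym (cong₂ _,_ a≡R b≡W)) (trans (sym it) (cong₂ (iterate k) a≡R b≡W))) (returns-refl (R , W)))
      greatest′ : ∀ {d} → d ∣ g * R → d ∣ g * W → d ∣ g
      greatest′ d∣r d∣w = greatest (subst (_ ∣_) gR≡r d∣r) (subst (_ ∣_) gW≡w d∣w)
      g>0 : 0 < g
      g>0 = <ᵇ⇒< 0 g t₀
      eq′ : a * (g * W) ≡ b * (g * R)
      eq′ = subst₂ (λ u v → a * u ≡ b * v) (sym gW≡w) (sym gR≡r) eq
      values : PrimeMax a b ⊎ PrimeMax b a → a ≡ R × b ≡ W
      values (inj₁ (pr , b<a)) = primePart g g>0 pr b>0 b<a eq′ greatest′
      values (inj₂ (pr , a<b))
        with b≡W , a≡R ← primePart g g>0 pr a>0 a<b (sym eq′) (λ d∣w d∣r → greatest′ d∣r d∣w) = a≡R , b≡W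

-- `a`, `b` open the first run and `x`, `e` close it; the primed letters do so for the second. One
-- full turn fixes `(a , b)`, which yields both the characteristic equation and the ratio tested at
-- the leaves.
noPositiveCycle : ∀ {fuel i j a b x e a′ b′ x′ e′} {p₁ q₁ p₂ q₂ : ℕ} → Refuted fuel i j →
  0 < a → 0 < b → p₁ ∈ from 1 → q₁ ∈ from 1 → p₂ ∈ from 1 → q₂ ∈ from 1 →
  (p₁ ≡ 1 × PrimeMax a b) ⊎ (q₁ ≡ 1 × PrimeMax b a) →
  Linear (2 ^ i) (averages i) a b x e → a′ * p₂ ≡ x + e → b′ * q₂ ≡ e + a′ →
  Linear (2 ^ j) (averages j) a′ b′ x′ e′ → a * p₁ ≡ x′ + e′ → b * q₁ ≡ e′ + a →
  iterate (4 + i + j) a b ≢ (a , b)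
noPositiveCycle {fuel} {i} {j} {a} {b} {p₁ = P₁} {Q₁} {P₂} {Q₂}
    ref a>0 b>0 ∈p₁ ∈q₁ ∈p₂ ∈q₂ peak run₁ ea′ eb′ run₂ ea eb it = contra peak
  where
  xs : Vec ℕ 4
  xs = P₁ ∷ Q₁ ∷ P₂ ∷ Q₂ ∷ []
  K = ⟦ scale i j ⟧ xs
  M = ⟦ cycleMat i j ⟧ᴹ xs
  step : Linear K M a b a b
  step = Linear-compose {⟦ runScale i p₂ q₂ ⟧ xs} {⟦ runMat i p₂ q₂ ⟧ᴹ xs} {⟦ runScale j p₁ q₁ ⟧ xs} {⟦ runMat j p₁ q₁ ⟧ᴹ xs}
             (run-linear i p₂ q₂ xs run₁ ea′ eb′) (run-linear j p₁ q₁ xs run₂ ea eb)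
  ratio : a * (K ∸ m₁₁ M) ≡ b * m₁₂ M
  ratio = begin
    a * (K ∸ m₁₁ M)                     ≡⟨ *-distribˡ-∸ a K (m₁₁ M) ⟩
    a * K ∸ a * m₁₁ M                   ≡⟨ cong₂ _∸_ (trans (*-comm a K) (Linear.top step)) (*-comm a (m₁₁ M)) ⟩
    m₁₁ M * a + m₁₂ M * b ∸ m₁₁ M * a   ≡⟨ m+n∸m≡n (m₁₁ M * a) _ ⟩
    m₁₂ M * b                           ≡⟨ *-comm (m₁₂ M) b ⟩
    b * m₁₂ M                           ∎
    where open ≡-Reasoning
  primeMax : (P₁ ≡ 1 × PrimeMax a b) ⊎ (Q₁ ≡ 1 × PrimeMax b a) → PrimeMax a b ⊎ PrimeMax b a
  primeMax (inj₁ (_ , pm)) = inj₁ pm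
  primeMax (inj₂ (_ , pm)) = inj₂ pm
  open Search (scale i j) (cycleMat i j) (leaf i j) using (search)
  sound : ∀ {rs} → Pointwise _∈_ xs rs → T (search fuel rs) → ⊥
  sound = SearchSound.search-sound (scale i j) (cycleMat i j) (leaf i j) xs (Linear-fixed {K} {M} a>0 b>0 step)
            (leaf-sound {4 + i + j} {m₁₂ M} {K ∸ m₁₁ M} a>0 b>0 (primeMax peak) ratio it) fuel
  rs₁ rs₂ : Vec Range 4
  rs₁ = exactly 1 ∷ from 1 ∷ from 1 ∷ from 1 ∷ []
  rs₂ = from 1 ∷ exactly 1 ∷ from 1 ∷ from 1 ∷ []
  refs : T (search fuel rs₁) × T (search fuel rs₂)
  refs = T-∧⁻ {search fuel rs₁} {search fuel rs₂} (Refuted.check ref)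
  contra : (P₁ ≡ 1 × PrimeMax a b) ⊎ (Q₁ ≡ 1 × PrimeMax b a) → ⊥
  contra (inj₁ (P₁≡1 , _)) =
    sound {rs₁} (subst (λ p → p ∈ exactly 1) (sym P₁≡1) isBase ∷ ∈q₁ ∷ ∈p₂ ∷ ∈q₂ ∷ []) (proj₁ refs)
  contra (inj₂ (Q₁≡1 , _)) =
    sound {rs₂} (∈p₁ ∷ subst (λ q → q ∈ exactly 1) (sym Q₁≡1) isBase ∷ ∈p₂ ∷ ∈q₂ ∷ []) (proj₂ refs)

-- Parity and the largest term

odd⇒1+2k : ∀ n → ¬ 2 ∣ n → ∃[ k ] n ≡ 1 + 2 * k
odd⇒1+2k zero          odd = contradiction (2 ∣0) odd
odd⇒1+2k (suc zero)    odd = 0 , refl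
odd⇒1+2k (suc (suc n)) odd with k , n≡1+2k ← odd⇒1+2k n (λ 2∣n → odd (∣m∣n⇒∣m+n ∣-refl 2∣n)) =
  suc k , trans (cong (2 +_) n≡1+2k) (step k)
  where
  step : ∀ k → 2 + (1 + 2 * k) ≡ 1 + 2 * suc k
  step = solve-∀

odd+odd : ∀ {x y} → ¬ 2 ∣ x → ¬ 2 ∣ y → 2 ∣ x + y
odd+odd {x} {y} ox oy with j , x≡ ← odd⇒1+2k x ox | k , y≡ ← odd⇒1+2k y oy =
  divides (1 + j + k) (trans (cong₂ _+_ x≡ y≡) (halve j k))
  where
  halve : ∀ j k → (1 + 2 * j) + (1 + 2 * k) ≡ (1 + j + k) * 2
  halve = solve-∀

odd+even : ∀ {x y} → ¬ 2 ∣ x → 2 ∣ y → ¬ 2 ∣ x + y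
odd+even {x} {y} ox ey e = ox (∣m+n∣m⇒∣n (subst (2 ∣_) (+-comm x y) e) ey)

even+odd : ∀ {x y} → 2 ∣ x → ¬ 2 ∣ y → ¬ 2 ∣ x + y
even+odd ex oy e = oy (∣m+n∣m⇒∣n e ex)

prime⇒≥2 : ∀ {p} → Prime p → 2 ≤ p
prime⇒≥2 {p} pr = nonTrivial⇒n>1 p {{prime⇒nonTrivial pr}}

evenPrime : ∀ {p} → Prime p → 2 ∣ p → p ≡ 2
evenPrime pr 2∣p with prime⇒irreducible pr 2∣p
... | inj₁ ()
... | inj₂ 2≡p = sym 2≡p

-- A quotient 1 would make a composite sum equal to its prime factor.
Next-≥2 : ∀ {x y z} → 2 ≤ x + y → Next x y z → 2 ≤ z
Next-≥2 s≥2 (inj₁ (_ , z≡s)) = subst (2 ≤_) (sym z≡s) s≥2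
Next-≥2 {z = zero} s≥2 (inj₂ (_ , p , _ , 0≡s)) = contradiction (subst (2 ≤_) (sym 0≡s) s≥2) λ ()
Next-≥2 {z = suc zero} s≥2 (inj₂ (¬pr , p , (pr , _) , p≡s)) =
  contradiction (subst Prime (trans (sym (+-identityʳ p)) p≡s) pr) ¬pr
Next-≥2 {z = suc (suc z)} s≥2 (inj₂ _) = s≤s (s≤s z≤n)

-- The sum is at least 4, so being even it is not prime, and its least prime factor is 2.
Next-even : ∀ {x y z} → 2 ≤ x → 2 ≤ y → 2 ∣ x + y → Next x y z → z * 2 ≡ x + y
Next-even x≥2 y≥2 e (inj₁ (pr , _)) =
  contradiction (evenPrime pr e) (≢-sym (<⇒≢ (≤-trans (s≤s (s≤s (s≤s z≤n))) (+-mono-≤ x≥2 y≥2))))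
Next-even {z = z} x≥2 y≥2 e (inj₂ (_ , p , (pr , _ , least) , z*p≡s)) =
  trans (cong (z *_) (≤-antisym (prime⇒≥2 pr) (least 2 prime[2] e))) z*p≡s

-- A prime sum is treated as divided by 1, so both cases of the rule become one equation with an odd
-- divisor.
Next-odd : ∀ {x y z} → ¬ 2 ∣ x + y → Next x y z → ¬ 2 ∣ z × ∃[ p ] p ∈ from 1 × z * p ≡ x + y
Next-odd {z = z} o (inj₁ (_ , z≡s)) =
  (λ 2∣z → o (subst (2 ∣_) z≡s 2∣z)) , 1 , above 0 refl , trans (*-identityʳ z) z≡s
Next-odd {z = z} o (inj₂ (_ , p , (_ , p∣s , _) , z*p≡s)) with k , p≡ ← odd⇒1+2k p (λ 2∣p → o (∣-trans 2∣p p∣s)) =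
  (λ 2∣z → o (∣-trans 2∣z (divides p (trans (sym z*p≡s) (*-comm z p))))) , p , above k p≡ , z*p≡s

record Orbit (m : ℕ) (t : ℕ → ℕ) : Set where
  field
    m-pos    : 0 < m
    periodic : ∀ i → t (i + m) ≡ t i
    t≥2      : ∀ i → 2 ≤ t i
    rule     : ∀ i → Next (t i) (t (1 + i)) (t (2 + i))

  periodic* : ∀ k i → t (i + k * m) ≡ t i
  periodic* zero    i = cong t (+-identityʳ i)
  periodic* (suc k) i = begin
    t (i + (m + k * m)) ≡⟨ cong t (trans (cong (i +_) (+-comm m (k * m))) (sym (+-assoc i (k * m) m))) ⟩
    t (i + k * m + m)   ≡⟨ periodic (i + k * m) ⟩
    t (i + k * m)       ≡⟨ periodic* k i ⟩
    t i                 ∎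
    where open ≡-Reasoning

  j≤jm : ∀ j → j ≤ j * m
  j≤jm j = m≤m*n j m {{>-nonZero m-pos}}

  -- Adding `j` periods moves `i` beyond `j`, so forward induction from `j` covers all the terms.
  reaches : ∀ j i → ∃[ n ] t (n + j) ≡ t i
  reaches j i = i + j * m ∸ j , trans (cong t (m∸n+n≡m (≤-trans (j≤jm j) (m≤n+m (j * m) i)))) (periodic* j i)

  shift : ∀ c → Orbit m (λ n → t (n + c))
  shift c = record
    { m-pos    = m-pos
    ; periodic = λ i → trans
        (cong t (trans (+-assoc i m c) (trans (cong (i +_) (+-comm m c)) (sym (+-assoc i c m)))))
        (periodic (i + c))
    ; t≥2      = λ i → t≥2 (i + c)
    ; rule     = λ i → rule (i + c)
    }

  argmax : ∀ n → ∃[ i ] (∀ j → j < suc n → t j ≤ t i)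
  argmax zero = 0 , λ { zero _ → ≤-refl ; (suc j) (s≤s ()) }
  argmax (suc n) with i , max ← argmax n with ≤-total (t i) (t (suc n))
  ... | inj₁ ti≤ = suc n , λ j j<2+n → case₁ (m≤n⇒m<n∨m≡n (≤-pred j<2+n))
    where
    case₁ : ∀ {j} → j < suc n ⊎ j ≡ suc n → t j ≤ t (suc n)
    case₁ (inj₁ j<) = ≤-trans (max _ j<) ti≤
    case₁ (inj₂ refl) = ≤-refl
  ... | inj₂ ≤ti = i , λ j j<2+n → case₂ (m≤n⇒m<n∨m≡n (≤-pred j<2+n))
    where
    case₂ : ∀ {j} → j < suc n ⊎ j ≡ suc n → t j ≤ t i
    case₂ (inj₁ j<) = max _ j<
    case₂ (inj₂ refl) = ≤ti

  maximum : ∃[ i ] (∀ j → t j ≤ t i)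
  maximum with i , max ← argmax m = i , λ j → subst (_≤ t i) (reduce j) (max (j % m) (m<n⇒m<1+n (m%n<n j m)))
    where
    instance
      m≢0 : NonZero m
      m≢0 = >-nonZero m-pos
    reduce : ∀ j → t (j % m) ≡ t j
    reduce j = trans (sym (periodic* (j / m) (j % m))) (cong t (sym (m≡m%n+[m/n]*n j m)))

  -- Two consecutive terms `P` have the even sum `2P`, which is halved to `P` again.
  constant : ∀ {P} j → t j ≡ P → t (1 + j) ≡ P → ∀ i → t i ≡ P
  constant {P} j tj tj′ i with n , tn ← reaches j i = trans (sym tn) (proj₁ (forward n))
    where
    forward : ∀ n → t (n + j) ≡ P × t (1 + n + j) ≡ P
    forward zero    = tj , tj′
    forward (suc n) with a , b ← forward n = b , *-cancelʳ-≡ _ _ 2 (begin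
      t (2 + n + j) * 2           ≡⟨ Next-even (t≥2 (n + j)) (t≥2 (1 + n + j)) 2∣sum (rule (n + j)) ⟩
      t (n + j) + t (1 + n + j)   ≡⟨ sum ⟩
      P * 2                       ∎)
      where
      open ≡-Reasoning
      sum : t (n + j) + t (1 + n + j) ≡ P * 2
      sum = trans (cong₂ _+_ a b) (double P)
        where
        double : ∀ P → P + P ≡ P * 2
        double = solve-∀
      2∣sum : 2 ∣ t (n + j) + t (1 + n + j)
      2∣sum = divides P sum

  -- If the maximum `P` came from a division by `p ≥ 2`, then `2P` would be at most the sum of two
  -- terms not exceeding `P`. Both would equal `P`, and the sequence would be constant.
  peak : ∃[ i ] ∃[ j ] t i ≢ t j → ∃[ j ] Prime (t (2 + j)) × t (2 + j) ≡ t j + t (1 + j) × (∀ i → t i ≤ t (2 + j))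
  peak (i₁ , i₂ , t≢) with i , max ← maximum with j , tj ← reaches 2 i = j , result (rule j)
    where
    P = t (2 + j)
    max′ : ∀ n → t n ≤ P
    max′ n = ≤-trans (max n) (≤-reflexive (trans (sym tj) (cong t (+-comm j 2))))
    result : Next (t j) (t (1 + j)) P → Prime P × P ≡ t j + t (1 + j) × (∀ i → t i ≤ P)
    result (inj₁ (pr , P≡)) = subst Prime (sym P≡) pr , P≡ , max′
    result (inj₂ (_ , p , (pr , _) , Pp≡)) = contradiction (trans (const i₁) (sym (const i₂))) t≢
      where
      open ≤-Reasoning
      P+P≤ : P + P ≤ t j + t (1 + j)
      P+P≤ = begin
        P + P           ≡⟨ cong (P +_) (+-identityʳ P) ⟨
        2 * P           ≤⟨ *-monoˡ-≤ P (prime⇒≥2 pr) ⟩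
        p * P           ≡⟨ *-comm p P ⟩
        P * p           ≡⟨ Pp≡ ⟩
        t j + t (1 + j) ∎
      const : ∀ n → t n ≡ P
      const = constant j
        (≤-antisym (max′ j) (+-cancelʳ-≤ P P (t j) (≤-trans P+P≤ (+-monoʳ-≤ (t j) (max′ (1 + j))))))
        (≤-antisym (max′ (1 + j)) (+-cancelˡ-≤ P P (t (1 + j)) (≤-trans P+P≤ (+-monoˡ-≤ (t (1 + j)) (max′ j)))))

  NoEvenPair : Set
  NoEvenPair = ∀ n → ¬ (2 ∣ t n × 2 ∣ t (1 + n))

  -- An even term preceded by an odd one has an odd successor. Starting at the odd term `t j`, this
  -- propagates around the cycle.
  noEvenPair : ∀ j → ¬ 2 ∣ t j → NoEvenPair
  noEvenPair j oj n (e , e′) = forward (n + j * m ∸ j)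
    (subst (λ k → 2 ∣ t k × 2 ∣ t (1 + k)) (sym (m∸n+n≡m (≤-trans (j≤jm j) (m≤n+m (j * m) n))))
      (subst (2 ∣_) (sym (periodic* j n)) e , subst (2 ∣_) (sym (periodic* j (1 + n))) e′))
    where
    forward : ∀ n → ¬ (2 ∣ t (n + j) × 2 ∣ t (1 + n + j))
    forward zero    (e , _)  = oj e
    forward (suc n) (e , e′) = proj₁ (Next-odd {t (n + j)} {t (1 + n + j)} (odd+even (λ e₀ → forward n (e₀ , e)) e) (rule (n + j))) e′

orbit : ∀ {m t} → NontrivialCycle m t → Orbit m t
orbit {m} {t} cyc = record { m-pos = m-pos ; periodic = periodic ; t≥2 = t≥2 m m-pos periodic ; rule = rule }
  where
  open NontrivialCycle cyc
  t≥2 : ∀ m → 0 < m → (∀ i → t (i + m) ≡ t i) → ∀ i → 2 ≤ t i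
  -- Two periods after `i` the index is at least 2, so the value there is produced by the rule from
  -- positive terms.
  t≥2 (suc k) _ periodic i = subst (2 ≤_)
    (trans (cong t (shiftTwo i k)) (trans (periodic (i + suc k)) (periodic i)))
    (Next-≥2 {t (i + k + k)} {t (suc (i + k + k))} (+-mono-≤ (positive (i + k + k)) (positive (suc (i + k + k)))) (rule (i + k + k)))
    where
    shiftTwo : ∀ i k → 2 + (i + k + k) ≡ i + suc k + suc k
    shiftTwo = solve-∀

-- Runs

least : ∀ {P : ℕ → Set} → Decidable P → ∀ n → P n → ∃[ l ] l ≤ n × (∀ l′ → l′ < l → ¬ P l′) × P l
least P? n pn with P? 0
least P? n       pn | yes p₀ = 0 , z≤n , (λ _ ()) , p₀
least P? zero    pn | no ¬p₀ = contradiction pn ¬p₀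
least P? (suc n) pn | no ¬p₀ with l , l≤n , below , pl ← least (λ k → P? (suc k)) n pn =
  suc l , s≤s l≤n , (λ { zero _ → ¬p₀ ; (suc l′) (s≤s l′<l) → below l′ l′<l }) , pl

-- The block of terms from the first odd one, at 2 + i, to the next even one, at 4 + l + i.
record Run (t : ℕ → ℕ) (i l : ℕ) : Set where
  field
    even-before : 2 ∣ t (1 + i)
    odd-block   : ∀ n → n < 2 + l → ¬ 2 ∣ t (n + (2 + i))
    even-end    : 2 ∣ t (4 + l + i)

module Runs {m t} (O : Orbit m t) (nep : Orbit.NoEvenPair O) where
  open Orbit O

  Divisors : ℕ → Set
  Divisors i = ∃[ p ] ∃[ q ] p ∈ from 1 × q ∈ from 1 × t (2 + i) * p ≡ t i + t (1 + i) × t (3 + i) * q ≡ t (1 + i) + t (2 + i)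

  afterEven : ∀ i → 2 ∣ t (1 + i) → ¬ 2 ∣ t (2 + i) × ¬ 2 ∣ t (3 + i) × Divisors i
  afterEven i e
    with oa , p , p∈ , p≡ ← Next-odd {t i} {t (1 + i)} (odd+even (λ e₀ → nep i (e₀ , e)) e) (rule i)
    with ob , q , q∈ , q≡ ← Next-odd {t (1 + i)} {t (2 + i)} (even+odd e oa) (rule (1 + i)) =
    oa , ob , p , q , p∈ , q∈ , p≡ , q≡

  -- `r` is the distance to some later even term, which bounds the search for the nearest one;
  -- `afterEven` rules out distances 1 and 2.
  findRun : ∀ i r → 2 ∣ t (1 + i) → 0 < r → 2 ∣ t (1 + (r + i)) → ∃[ l ] 3 + l ≤ r × Run t i l
  findRun i (suc zero)          e _ e′ = contradiction e′ (proj₁ (afterEven i e))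
  findRun i (suc (suc zero))    e _ e′ = contradiction e′ (proj₁ (proj₂ (afterEven i e)))
  findRun i (suc (suc (suc r))) e _ e′
    with oa , ob , _ ← afterEven i e
    with l , l≤r , below , el ← least (λ n → 2 ∣? t (4 + n + i)) r e′ =
    l , s≤s (s≤s (s≤s l≤r)) , record { even-before = e ; odd-block = block ; even-end = el }
    where
    block : ∀ n → n < 2 + l → ¬ 2 ∣ t (n + (2 + i))
    block zero          _ = oa
    block (suc zero)    _ = ob
    block (suc (suc n)) (s≤s (s≤s n<l)) =
      subst (λ k → ¬ 2 ∣ t (2 + k)) (sym (trans (+-suc n (1 + i)) (cong suc (+-suc n i)))) (below n n<l)

  -- The `2 + l` odd terms have `1 + l` sums of neighbours, all even and hence halved; the last one
  -- produces the closing even term.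
  run-averages : ∀ {i l} → Run t i l →
    Linear (2 ^ suc l) (averages (suc l)) (t (2 + i)) (t (3 + i)) (t (3 + l + i)) (t (4 + l + i))
  run-averages {i} {l} run = subst (λ k → Linear (2 ^ suc l) (averages (suc l)) (t (2 + i)) (t (3 + i)) (t (1 + k)) (t (2 + k)))
    (trans (+-suc l (1 + i)) (cong suc (+-suc l i)))
    (averages-linear (suc l) (λ n → t (n + (2 + i))) λ n n≤l →
      Next-even (t≥2 _) (t≥2 _) (odd+odd (odd-block n (m<n⇒m<1+n n≤l)) (odd-block (1 + n) (s≤s n≤l))) (rule (n + (2 + i))))
    where open Run run

  -- Used after a rotation that puts the even summand of the largest term at index 1. The largest
  -- term is then at 2 or 3, according as that summand is the later or the earlier one.
  Peak : Set
  Peak = (Prime (t 2) × t 2 ≡ t 0 + t 1 × (∀ i → t i ≤ t 2)) ⊎ (Prime (t 3) × t 3 ≡ t 1 + t 2)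

  startDivisors : Peak → 2 ∣ t 1 → ∃[ p ] ∃[ q ] p ∈ from 1 × q ∈ from 1 × t 2 * p ≡ t 0 + t 1 × t 3 * q ≡ t 1 + t 2 ×
                  ((p ≡ 1 × PrimeMax (t 2) (t 3)) ⊎ (q ≡ 1 × PrimeMax (t 3) (t 2)))
  startDivisors (inj₁ (pr , P≡ , max)) e with _ , _ , p , q , p∈ , q∈ , p≡ , q≡ ← afterEven 0 e =
    1 , q , above 0 refl , q∈ , trans (*-identityʳ (t 2)) P≡ , q≡ , inj₁ (refl , pr , t₃<t₂ q q∈ q≡)
    where
    open ≤-Reasoning
    t₁<t₂ : t 1 < t 2
    t₁<t₂ = subst (t 1 <_) (sym P≡) (m<n+m (t 1) (≤-trans (s≤s z≤n) (t≥2 0)))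
    -- With `q = 1`, `t 3 = t 1 + t 2` would exceed the maximum `t 2`. Otherwise `q ≥ 3`, and
    -- `2 * t 3 ≤ t 1 + t 2 < 2 * t 2`.
    t₃<t₂ : ∀ q → q ∈ from 1 → t 3 * q ≡ t 1 + t 2 → t 3 < t 2
    t₃<t₂ q (above zero refl) q≡ = contradiction (max 3) (<⇒≱ (begin-strict
      t 2       <⟨ m<n+m (t 2) (≤-trans (s≤s z≤n) (t≥2 1)) ⟩
      t 1 + t 2 ≡⟨ trans (sym q≡) (*-identityʳ (t 3)) ⟩
      t 3       ∎))
    t₃<t₂ q (above (suc n) refl) q≡ = *-cancelʳ-< 2 (t 3) (t 2) (begin-strict
      t 3 * 2               ≤⟨ *-monoʳ-≤ (t 3) (s≤s (s≤s z≤n)) ⟩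
      t 3 * (1 + 2 * suc n) ≡⟨ q≡ ⟩
      t 1 + t 2             <⟨ +-monoˡ-< (t 2) t₁<t₂ ⟩
      t 2 + t 2             ≡⟨ double (t 2) ⟩
      t 2 * 2               ∎)
      where
      double : ∀ n → n + n ≡ n * 2
      double = solve-∀
  startDivisors (inj₂ (pr , P≡)) e with _ , _ , p , q , p∈ , q∈ , p≡ , q≡ ← afterEven 0 e =
    p , 1 , p∈ , above 0 refl , p≡ , trans (*-identityʳ (t 3)) P≡ ,
    inj₂ (refl , pr , subst (t 2 <_) (sym P≡) (m<n+m (t 2) (≤-trans (s≤s z≤n) (t≥2 1))))

  -- The period assumed here is the total length of the two runs. It may be `m` or `2m`, so a single
  -- run traversed twice is included.
  noTwoRuns : ∀ {fuel l l′} → Refuted fuel (1 + l) (1 + l′) → Peak → Run t 0 l → Run t (3 + l) l′ →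
              (∀ n → t (6 + l + l′ + n) ≡ t n) → ⊥
  noTwoRuns {fuel} {l} {l′} ref pk run run′ period
    with p₁ , q₁ , ∈p₁ , ∈q₁ , p₁≡ , q₁≡ , pm ← startDivisors pk (Run.even-before run)
    with _ , _ , p₂ , q₂ , ∈p₂ , ∈q₂ , p₂≡ , q₂≡ ← afterEven (3 + l) (Run.even-before run′) =
    noPositiveCycle {fuel} {1 + l} {1 + l′} ref (≤-trans (s≤s z≤n) (t≥2 2)) (≤-trans (s≤s z≤n) (t≥2 3)) ∈p₁ ∈q₁ ∈p₂ ∈q₂ pm
      (subst₂ (Linear (2 ^ suc l) (averages (suc l)) (t 2) (t 3))
        (cong (λ k → t (3 + k)) (+-identityʳ l)) (cong (λ k → t (4 + k)) (+-identityʳ l)) (run-averages run))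
      p₂≡ q₂≡
      (subst₂ (Linear (2 ^ suc l′) (averages (suc l′)) (t (5 + l)) (t (6 + l)))
        (back 0 (index 0 l l′)) (back 1 (index 1 l l′)) (run-averages run′))
      p₁≡ q₁≡
      (trans (iterate-next (λ i → ≤-trans (s≤s z≤n) (t≥2 i)) rule (4 + (1 + l) + (1 + l′)) 2)
        (cong₂ _,_ (back 2 (index₂ 0 l l′)) (back 3 (index₂ 1 l l′))))
    where
    back : ∀ {k} n → k ≡ 6 + l + l′ + n → t k ≡ t n
    back n k≡ = trans (cong t k≡) (period n)
    index : ∀ n l l′ → n + (3 + l′ + (3 + l)) ≡ 6 + l + l′ + n
    index = solve-∀
    index₂ : ∀ n l l′ → n + (4 + (1 + l) + (1 + l′) + 2) ≡ 6 + l + l′ + (2 + n)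
    index₂ = solve-∀

-- Three runs in every cycle of length at most 11

-- `k₁` and `k₂` are lengths of runs; `k₃` is the rest of the period and may contain further even
-- terms.
record ThreeRuns (m : ℕ) (t : ℕ → ℕ) : Set where
  constructor threeRuns
  field
    k₁ k₂ k₃ : ℕ
    long₁    : 3 ≤ k₁
    long₂    : 3 ≤ k₂
    long₃    : 3 ≤ k₃
    total    : k₃ + (k₂ + k₁) ≡ m
    even₁    : 2 ∣ t 0
    even₂    : 2 ∣ t k₁
    even₃    : 2 ∣ t (k₂ + k₁)

module _ (fuel : ℕ) (all-refuted : AllRefuted fuel) where

  module _ {m t} (O : Orbit m t) (nep : Orbit.NoEvenPair O) where
    open Orbit O
    open Runs O nep

    -- Runs are cut off one by one from the even term `t 1`. If the period is exhausted after one or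
    -- two of them, `noTwoRuns` applies.
    peak⇒threeRuns : m ≤ 11 → Peak → 2 ∣ t 1 → ThreeRuns m (λ n → t (n + 1))
    peak⇒threeRuns m≤11 pk e = afterFirst (findRun 0 m e m-pos (evenAfter _ (+-identityʳ m)))
      where
      evenAfter : ∀ k → k ≡ m → 2 ∣ t (1 + k)
      evenAfter k k≡m = subst (2 ∣_) (sym (trans (cong (λ n → t (1 + n)) k≡m) (periodic 1))) e

      -- The run and its translate by `m` play the parts of the two runs.
      oneRun : ∀ {l} → Run t 0 l → 3 + l ≡ m → ⊥
      oneRun {l} run k≡m = noTwoRuns {fuel} (all-refuted l<9 l<9 (inj₂ refl)) pk run repeated λ n →
          trans (cong t (twice n)) (trans (periodic (n + m)) (periodic n))
        where
        l<9 : l < 9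
        l<9 = +-cancelˡ-≤ 2 _ 9 (subst (_≤ 11) (sym k≡m) m≤11)
        rearrange : ∀ n l → 6 + l + l + n ≡ n + (3 + l) + (3 + l)
        rearrange = solve-∀
        twice : ∀ n → 6 + l + l + n ≡ n + m + m
        twice n = trans (rearrange n l) (cong (λ k → n + k + k) k≡m)
        open Run run
        repeated : Run t (3 + l) l
        repeated = subst (λ k → Run t k l) (sym k≡m) (record
          { even-before = subst (2 ∣_) (sym (periodic 1)) even-before
          ; odd-block   = λ n n<2+l → subst (λ x → ¬ 2 ∣ x)
              (sym (trans (cong t (sym (+-assoc n 2 m))) (periodic (n + 2)))) (odd-block n n<2+l)
          ; even-end    = subst (2 ∣_) (sym (trans (periodic (4 + l)) (cong (λ k → t (4 + k)) (sym (+-identityʳ l))))) even-end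
          })

      twoRuns : ∀ {l l′} → Run t 0 l → Run t (3 + l) l′ → 3 + l + (3 + l′) ≡ m → ⊥
      twoRuns {l} {l′} run run′ k≡m = noTwoRuns {fuel}
          (all-refuted (<9 (m≤m+n l l′)) (<9 (m≤n+m l′ l)) (inj₁ l+l′≤5)) pk run run′ λ n →
          trans (cong t (trans (cong (_+ n) total) (+-comm m n))) (periodic n)
        where
        rearrange : ∀ l l′ → 6 + l + l′ ≡ 3 + l + (3 + l′)
        rearrange = solve-∀
        total : 6 + l + l′ ≡ m
        total = trans (rearrange l l′) k≡m
        l+l′≤5 : l + l′ ≤ 5
        l+l′≤5 = +-cancelˡ-≤ 6 _ 5 (subst (_≤ 11) (sym total) m≤11)
        <9 : ∀ {k} → k ≤ l + l′ → k < 9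
        <9 k≤ = s≤s (≤-trans k≤ (≤-trans l+l′≤5 (m≤m+n 5 3)))

      afterSecond : ∀ {l l′ r} → Run t 0 l → Run t (3 + l) l′ → r + (3 + l′ + (3 + l)) ≡ m →
                    ∃[ l″ ] 3 + l″ ≤ r × Run t (3 + l′ + (3 + l)) l″ →
                    ThreeRuns m (λ n → t (n + 1))
      afterSecond {l} {l′} {r} run run′ total (l″ , k≤r , _) = record
        { k₁ = 3 + l ; k₂ = 3 + l′ ; k₃ = r
        ; long₁ = m≤m+n 3 l ; long₂ = m≤m+n 3 l′ ; long₃ = ≤-trans (m≤m+n 3 l″) k≤r
        ; total = total
        ; even₁ = e
        ; even₂ = subst (λ k → 2 ∣ t k) (+-comm 1 (3 + l)) (Run.even-before run′)
        ; even₃ = subst (λ k → 2 ∣ t k) (+-comm 1 (3 + l′ + (3 + l))) (Run.even-end run′)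
        }

      afterFirst′ : ∀ {l r} → Run t 0 l → 3 + l + r ≡ m → ∃[ l′ ] 3 + l′ ≤ r × Run t (3 + l) l′ →
                    ThreeRuns m (λ n → t (n + 1))
      afterFirst′ {l} {r} run eq (l′ , k≤r , run′) with m≤n⇒∃[o]m+o≡n k≤r
      ... | zero , eq′ = ⊥-elim (twoRuns run run′ (trans (cong (3 + l +_) (trans (sym (+-identityʳ (3 + l′))) eq′)) eq))
      ... | suc r′ , eq′ = afterSecond run run′ total (findRun _ (suc r′) (Run.even-end run′) (s≤s z≤n) (evenAfter _ total))
        where
        rearrange : ∀ a b c → a + (b + c) ≡ c + (b + a)
        rearrange = solve-∀
        total : suc r′ + (3 + l′ + (3 + l)) ≡ m
        total = trans (rearrange (suc r′) (3 + l′) (3 + l)) (trans (cong (3 + l +_) eq′) eq)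

      afterFirst : ∃[ l ] 3 + l ≤ m × Run t 0 l → ThreeRuns m (λ n → t (n + 1))
      afterFirst (l , k≤m , run) with m≤n⇒∃[o]m+o≡n k≤m
      ... | zero  , eq = ⊥-elim (oneRun run (trans (sym (+-identityʳ (3 + l))) eq))
      ... | suc r , eq = afterFirst′ run eq (findRun (3 + l) (suc r)
              (subst (λ k → 2 ∣ t (4 + k)) (+-identityʳ l) (Run.even-end run)) (s≤s z≤n) (evenAfter _ (trans (+-comm (suc r) (3 + l)) eq)))

-- Counting even terms

evenCount-+ : ∀ t r n → evenCount t (r + n) ≡ evenCount (λ i → t (i + n)) r + evenCount t n
evenCount-+ t zero    n = refl
evenCount-+ t (suc r) n with t (r + n) % 2
... | zero  = cong suc (evenCount-+ t r n)
... | suc _ = evenCount-+ t r n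

evenCount-cong : ∀ {t u} → (∀ i → t i ≡ u i) → ∀ n → evenCount t n ≡ evenCount u n
evenCount-cong         t≗u zero    = refl
evenCount-cong {t} {u} t≗u (suc n) rewrite t≗u n with u n % 2
... | zero  = cong suc (evenCount-cong t≗u n)
... | suc _ = evenCount-cong t≗u n

-- The first `m + c` terms are split after `c` and after `m`. By periodicity the last `c` of them
-- count like the first `c`, and this common count cancels.
evenCount-rotate : ∀ {m t} → (∀ i → t (i + m) ≡ t i) → ∀ c → evenCount (λ i → t (i + c)) m ≡ evenCount t m
evenCount-rotate {m} {t} periodic c = +-cancelʳ-≡ (evenCount t c) _ _ (begin
  evenCount (λ i → t (i + c)) m + evenCount t c ≡⟨ evenCount-+ t m c ⟨
  evenCount t (m + c)                           ≡⟨ cong (evenCount t) (+-comm m c) ⟩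
  evenCount t (c + m)                           ≡⟨ evenCount-+ t c m ⟩
  evenCount (λ i → t (i + m)) c + evenCount t m ≡⟨ cong (_+ evenCount t m) (evenCount-cong periodic c) ⟩
  evenCount t c + evenCount t m                 ≡⟨ +-comm (evenCount t c) _ ⟩
  evenCount t m + evenCount t c                 ∎)
  where open ≡-Reasoning

evenCount-positive : ∀ {t k} → 2 ∣ t 0 → 0 < k → 1 ≤ evenCount t k
evenCount-positive {t} {suc k} e _ = subst (1 ≤_)
  (sym (trans (cong (evenCount t) (+-comm 1 k)) (evenCount-+ t k 1))) (≤-trans first (m≤n+m _ (evenCount (λ i → t (i + 1)) k)))
  where
  first : 1 ≤ evenCount t 1
  first with t 0 % 2 | n∣m⇒m%n≡0 (t 0) 2 e
  ... | zero | _ = ≤-refl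

-- The period splits into three segments, each beginning with an even term.
threeRuns⇒evenCount : ∀ {m t} → ThreeRuns m t → 3 ≤ evenCount t m
threeRuns⇒evenCount {m} {t} (threeRuns k₁ k₂ k₃ l₁ l₂ l₃ refl e₁ e₂ e₃) = begin
  3
    ≤⟨ +-mono-≤ (positive₃ l₃ e₃) (+-mono-≤ (positive₃ l₂ e₂) (positive₃ l₁ e₁)) ⟩
  evenCount (λ i → t (i + (k₂ + k₁))) k₃ + (evenCount (λ i → t (i + k₁)) k₂ + evenCount t k₁)
    ≡⟨ cong (evenCount (λ i → t (i + (k₂ + k₁))) k₃ +_) (evenCount-+ t k₂ k₁) ⟨
  evenCount (λ i → t (i + (k₂ + k₁))) k₃ + evenCount t (k₂ + k₁)
    ≡⟨ evenCount-+ t k₃ (k₂ + k₁) ⟨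
  evenCount t (k₃ + (k₂ + k₁)) ∎
  where
  open ≤-Reasoning
  positive₃ : ∀ {u k} → 3 ≤ k → 2 ∣ u 0 → 1 ≤ evenCount u k
  positive₃ {u} k≥3 e = evenCount-positive {u} e (≤-trans (s≤s z≤n) k≥3)

cycle⇒threeRuns : ∀ fuel → AllRefuted fuel →
                  ∀ {m t} → NontrivialCycle m t → m ≤ 11 → ∃[ c ] ThreeRuns m (λ n → t (n + c))
cycle⇒threeRuns fuel ref {m} {t} cyc m≤11
  with j , pr , P≡ , max ← Orbit.peak (orbit cyc) (NontrivialCycle.not-const cyc) =
  choose-start (2 ∣? t j) (2 ∣? t (1 + j))
  where
  O = orbit cyc
  open Orbit O
  -- The prime is a sum of two terms that are at least 2, so it is not 2.
  P-odd : ¬ 2 ∣ t (2 + j)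
  P-odd e = <⇒≢ (≤-trans (s≤s (s≤s (s≤s z≤n))) (+-mono-≤ (t≥2 j) (t≥2 (1 + j)))) (trans (sym (evenPrime pr e)) P≡)
  nep : NoEvenPair
  nep = noEvenPair (2 + j) P-odd
  shifted : ∀ c → Runs.Peak (shift c) (λ n → nep (n + c)) → 2 ∣ t (1 + c) → ∃[ c ] ThreeRuns m (λ n → t (n + c))
  shifted c pk e = 1 + c , subst-shift (peak⇒threeRuns fuel ref (shift c) (λ n → nep (n + c)) m≤11 pk e)
    where
    subst-shift : ThreeRuns m (λ n → t (n + 1 + c)) → ThreeRuns m (λ n → t (n + (1 + c)))
    subst-shift r = record
      { k₁ = k₁ ; k₂ = k₂ ; k₃ = k₃ ; long₁ = long₁ ; long₂ = long₂ ; long₃ = long₃ ; total = total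
      ; even₁ = even₁ ; even₂ = subst (λ k → 2 ∣ t k) (+-assoc k₁ 1 c) even₂
      ; even₃ = subst (λ k → 2 ∣ t k) (+-assoc (k₂ + k₁) 1 c) even₃ }
      where open ThreeRuns r
  choose-start : Dec (2 ∣ t j) → Dec (2 ∣ t (1 + j)) → ∃[ c ] ThreeRuns m (λ n → t (n + c))
  choose-start (yes e₀) (yes e₁) = contradiction (e₀ , e₁) (nep j)
  choose-start (no o₀)  (no o₁)  = contradiction (subst (2 ∣_) (sym P≡) (odd+odd o₀ o₁)) P-odd
  choose-start (no _)   (yes e₁) = shifted j (inj₁ (pr , P≡ , λ i → max (i + j))) e₁
  choose-start (yes e₀) (no _)   = shifted c
                                     (inj₂ (subst Prime (sym (back 2)) pr , trans (back 2) (trans P≡ (sym (cong₂ _+_ (back 0) (back 1))))))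
                                     (subst (2 ∣_) (sym (back 0)) e₀)
    where
    -- The index before `j` modulo `m`, so that `t j` lands at index 1.
    c = m ∸ 1 + j
    back : ∀ n → t (1 + n + c) ≡ t (n + j)
    back n = trans (cong t wrap) (periodic (n + j))
      where
      wrap : 1 + n + c ≡ n + j + m
      wrap = trans (rearrange n (m ∸ 1) j) (cong (n + j +_) (m∸n+n≡m m-pos))
        where
        rearrange : ∀ n d j → 1 + n + (d + j) ≡ n + j + (d + 1)
        rearrange = solve-∀

-- Running the search, and the theorem

abstract
  -- Proved by evaluation for all `i`, `j` below 9; the number 1000 bounds the depth of the search
  -- trees.
  all-refuted : AllRefuted 1000
  all-refuted i<9 j<9 cases = holds (check i<9 j<9 cases)
    where
    check : ∀ {i} → i < 9 → ∀ {j} → j < 9 → i + j ≤ 5 ⊎ i ≡ j → T (refuted 1000 (1 + i) (1 + j))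
    check = from-yes (allUpTo? (λ i → allUpTo? (λ j →
      ((i + j ≤? 5) ⊎-dec (i ≟ j)) →-dec T? (refuted 1000 (1 + i) (1 + j))) 9) 9)

threeRuns-exist : ∀ {m t} → NontrivialCycle m t → m ≤ 11 → ∃[ c ] ThreeRuns m (λ n → t (n + c))
threeRuns-exist = cycle⇒threeRuns 1000 all-refuted

theorem17 : (∀ (m : ℕ) (t : ℕ → ℕ) → NontrivialCycle m t → ¬ (m ≤ 8))
    × (∀ (m : ℕ) (t : ℕ → ℕ) → NontrivialCycle m t → m ≤ 11 → ¬ (runs m t ≡ 2))
theorem17 = short , twoRuns
  where
  short : ∀ m t → NontrivialCycle m t → ¬ (m ≤ 8)
  short m t cyc m≤8
    with _ , threeRuns _ _ _ long₁ long₂ long₃ total _ _ _ ← threeRuns-exist cyc (m≤n⇒m≤n+o 3 m≤8) =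
    <⇒≱ (s≤s m≤8) (subst (9 ≤_) total (+-mono-≤ long₃ (+-mono-≤ long₂ long₁)))
  twoRuns : ∀ m t → NontrivialCycle m t → m ≤ 11 → ¬ (runs m t ≡ 2)
  twoRuns m t cyc m≤11 two with c , r ← threeRuns-exist cyc m≤11 =
    <⇒≢ (threeRuns⇒evenCount r) (sym (trans (evenCount-rotate (NontrivialCycle.periodic cyc) c) two))
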